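{- Let $\overrightarrow{C_n}$ be an oriented cycle on $n$ vertices. Then $$F(\overrightarrow{C_n})=\begin{cases}0, & \text{if it is a directed cycle},\\ n-1, & \text{otherwise.}\end{cases}$$
   Context: A finite simple digraph $D=(V,A)$ has finite nonempty vertex set $V$ and arc set $A$ consisting of ordered pairs of distinct vertices (no loops, no parallel arcs). $N_D^+(v)=\{u:(v,u)\in A\}$. An oriented graph is a digraph in which $(u,v)\in A$ implies $(v,u)\notin A$. An oriented cycle $\overrightarrow{C_n}$ is an oriented graph whose underlying undirected graph is the cycle $C_n$, $n\ge 3$. It is a directed cycle if its vertices can be labeled $v_1,\dots,v_n$ so that its arcs are exactly $(v_1,v_2),\dots,(v_{n-1},v_n),(v_n,v_1)$. Zero forcing: for $S\subseteq V$ let $B^0(S)=S$ and $B^{i+1}(S)=B^i(S)\cup\{w:\{w\}=N_D^+(v)\setminus B^i(S)\text{ for some }v\in B^i(S)\}$. $S$ is a zero forcing set (ZFS) if $B^t(S)=V$ for some $t\ge 0$, and a failed zero forcing set (FZFS) otherwise. The failed zero forcing number $F(D)$ is the largest cardinality of an FZFS of $D$. -}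

module Defs where

open import Data.Fin using (Fin; toℕ)
open import Data.Fin.Permutation using (Permutation′; _⟨$⟩ʳ_)
open import Data.Fin.Properties using (any?)
open import Data.Fin.Subset using (Subset; _∈_; _∪_; _─_; ⁅_⁆; ⊤; ∣_∣)
open import Data.Fin.Subset.Properties using (_∈?_)
import Data.Bool.Properties as Bool
open import Data.Nat using (ℕ; zero; suc; _≤_; NonZero)
open import Data.Product using (∃; ∃-syntax; _×_)
open import Data.Sum using (_⊎_)
open import Data.Vec using (tabulate)
open import Data.Vec.Properties using (≡-dec)
open import Function.Bundles using (_⇔_)
open import Level using (0ℓ)
open import Relation.Binary.Core using (Rel)
open import Relation.Binary.Construct.Closure.Symmetric using (SymClosure)
open import Relation.Binary.Definitions using (Asymmetric; Decidable; Irreflexive)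
open import Relation.Binary.PropositionalEquality using (_≡_)
open import Relation.Nullary using (Dec; does; ¬_; _×-dec_)

-- Finite simple digraphs, with vertex set V = Fin n. The arc set is finite, so
-- membership in it is decidable; constructively this has to be recorded.
record Digraph (n : ℕ) : Set₁ where
  infix 4 _⟶_ _⟶?_
  field
    nonEmpty : NonZero n
    _⟶_      : Rel (Fin n) 0ℓ
    _⟶?_     : Decidable _⟶_
    loopless : Irreflexive _≡_ _⟶_

  N⁺ : Fin n → Subset n
  N⁺ v = tabulate λ u → does (v ⟶? u)

IsOriented : ∀ {n} → Digraph n → Set
IsOriented D = Asymmetric (Digraph._⟶_ D)

Underlying : ∀ {n} → Digraph n → Rel (Fin n) 0ℓ
Underlying D = SymClosure (Digraph._⟶_ D)

-- The pairs (0 , 1), …, (n - 2 , n - 1), (n - 1 , 0).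
CyclicSuc : ∀ {n} → Rel (Fin n) 0ℓ
CyclicSuc {n} i j =
  (toℕ j ≡ suc (toℕ i)) ⊎ (suc (toℕ i) ≡ n × toℕ j ≡ 0)

-- Adjacency in the undirected cycle C_n.
CycleAdj : ∀ {n} → Rel (Fin n) 0ℓ
CycleAdj = SymClosure CyclicSuc

record IsOrientedCycle {n} (D : Digraph n) : Set where
  field
    3≤n      : 3 ≤ n
    oriented : IsOriented D
    cycle    : ∃ λ (π : Permutation′ n) → ∀ i j →
      Underlying D (π ⟨$⟩ʳ i) (π ⟨$⟩ʳ j) ⇔ CycleAdj i j

-- The labelling is v_{i+1} = π i.
IsDirectedCycle : ∀ {n} → Digraph n → Set
IsDirectedCycle {n} D = ∃ λ (π : Permutation′ n) → ∀ i j →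
  (π ⟨$⟩ʳ i ⟶ π ⟨$⟩ʳ j) ⇔ CyclicSuc i j
  where open Digraph D

module _ {n} (D : Digraph n) where
  open Digraph D

  Forced : Subset n → Fin n → Set
  Forced B w = ∃[ v ] (v ∈ B × N⁺ v ─ B ≡ ⁅ w ⁆)

  forced? : ∀ B w → Dec (Forced B w)
  forced? B w = any? λ v → (v ∈? B) ×-dec ≡-dec Bool._≟_ (N⁺ v ─ B) ⁅ w ⁆

  B[_] : ℕ → Subset n → Subset n
  B[ zero  ] S = S
  B[ suc i ] S = B[ i ] S ∪ tabulate λ w → does (forced? (B[ i ] S) w)

  IsZFS : Subset n → Set
  IsZFS S = ∃[ t ] B[ t ] S ≡ ⊤

  IsFZFS : Subset n → Set
  IsFZFS S = ¬ IsZFS S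

  -- F(D) = k: the largest cardinality of a failed zero forcing set is k.
  FailedZeroForcingNumberIs : ℕ → Set
  FailedZeroForcingNumberIs k =
    (∃[ S ] (IsFZFS S × ∣ S ∣ ≡ k)) × (∀ S → IsFZFS S → ∣ S ∣ ≤ k)

{-# OPTIONS --safe #-}
module Submission where

-- An oriented cycle without a source is directed: an arc running backwards into v forces,
-- as v has some in-neighbour, the next arc to run backwards too, so once one arc of a
-- cyclic labelling is backward they all are. Hence a non-directed oriented cycle has a
-- source, which is never forced, and its complement is a failed set. On a directed cycle
-- every vertex has a single out-neighbour, so one blue vertex colours the whole cycle.

open import Defs
open import Data.Fin using (Fin; zero; suc; toℕ; fromℕ; inject₁; opposite)
open import Data.Fin.Induction using (<-weakInduction; <-weakInduction-startingFrom)
open import Data.Fin.Permutation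
  using (Permutation′; _⟨$⟩ʳ_; _⟨$⟩ˡ_; inverseʳ; reverse; _∘ₚ_)
open import Data.Fin.Properties
  using (any?; all?; toℕ-injective; toℕ<n; toℕ-inject₁; toℕ-fromℕ; ≤fromℕ;
         opposite-prop; opposite-involutive)
open import Data.Fin.Subset using (_∈_; _∉_; _⊆_; _─_; ⁅_⁆; ⊤; ⊥; ∁; ∣_∣)
open import Data.Fin.Subset.Properties
  using (_∈?_; nonempty?; Empty-unique; ∉⊥; ∣⊥∣≡0; ∈⊤; ∣p∣≤n; ∣p∣≡n⇒p≡⊤; x∈⁅x⁆;
         x∈⁅y⁆⇒x≡y; ⊆-antisym; x∈p⇒x∉∁p; ∣∁p∣≡n∸∣p∣; ∣⁅x⁆∣≡1; p⊆p∪q; q⊆p∪q; x∈p∪q⁻;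
         p─q⊆p; x∈p∧x∉q⇒x∈p─q)
open import Data.Nat using (ℕ; zero; suc; _∸_; _≤_; _≤′_; ≤′-refl; ≤′-step; _⊔_; NonZero)
open import Data.Nat.Properties
  using (suc-injective; <-irrefl; +-∸-assoc; n∸n≡0; m≤m⊔n; m≤n⊔m; ≤⇒≤′; ≤-reflexive;
         ≤∧≢⇒<; <⇒≤pred)
  renaming (_≟_ to _≟ℕ_)
open import Data.Product using (∃; ∃-syntax; _×_; _,_; proj₁; proj₂)
open import Data.Sum using (inj₁; inj₂)
open import Data.Vec using (tabulate)
open import Data.Vec.Properties using ([]=⇒lookup; lookup⇒[]=; lookup∘tabulate)
open import Function using (_∘_; mk⇔; Equivalence)
open import Relation.Binary.Construct.Closure.Symmetric using (fwd; bwd)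
open import Relation.Binary.Definitions using (Decidable)
open import Relation.Binary.PropositionalEquality
  using (_≡_; refl; sym; trans; cong; subst; subst₂; module ≡-Reasoning)
open import Relation.Nullary
  using (yes; no; does; ¬_; ¬?; contradiction; _×-dec_; _⊎-dec_)
open import Relation.Nullary.Decidable using (decidable-stable; dec-true)
import Relation.Unary as Unary

module _ {n : ℕ} {P : Fin n → Set} (P? : Unary.Decidable P) where

  ∈-tabulate⁺ : ∀ {x} → P x → x ∈ tabulate (does ∘ P?)
  ∈-tabulate⁺ {x} px =
    lookup⇒[]= x _ (trans (lookup∘tabulate (does ∘ P?) x) (dec-true (P? x) px))

  ∈-tabulate⁻ : ∀ {x} → x ∈ tabulate (does ∘ P?) → P x
  ∈-tabulate⁻ {x} x∈ with P? x | trans (sym (lookup∘tabulate (does ∘ P?) x)) ([]=⇒lookup x∈)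
  ... | yes px | _  = px
  ... | no  _  | ()

-- Take the maximum of the finitely many times. This turns "each vertex is blue eventually" into a
-- single time at which all are blue.
uniform-bound : ∀ {n} (P : Fin n → ℕ → Set) → (∀ {i s t} → s ≤ t → P i s → P i t) →
  (∀ i → ∃[ t ] P i t) → ∃[ t ] ∀ i → P i t
uniform-bound {zero}  P mono h = 0 , λ ()
uniform-bound {suc n} P mono h with h zero | uniform-bound (P ∘ suc) mono (h ∘ suc)
... | s , p | t , ps = s ⊔ t , λ
  { zero    → mono (m≤m⊔n s t) p
  ; (suc i) → mono (m≤n⊔m s t) (ps i) }

-- Cyclic order on the indices and its reversal.

module _ {n : ℕ} where

  cyclicSuc? : Decidable (CyclicSuc {n})
  cyclicSuc? i j = (toℕ j ≟ℕ suc (toℕ i)) ⊎-dec ((suc (toℕ i) ≟ℕ n) ×-dec (toℕ j ≟ℕ 0))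

  cyclicSuc-functional : ∀ {i j k : Fin n} → CyclicSuc i j → CyclicSuc i k → j ≡ k
  cyclicSuc-functional (inj₁ p) (inj₁ q) = toℕ-injective (trans p (sym q))
  cyclicSuc-functional {j = j} (inj₁ p) (inj₂ (q , _)) =
    contradiction (toℕ<n j) (<-irrefl (trans p q))
  cyclicSuc-functional {k = k} (inj₂ (p , _)) (inj₁ q) =
    contradiction (toℕ<n k) (<-irrefl (trans q p))
  cyclicSuc-functional (inj₂ (_ , p)) (inj₂ (_ , q)) = toℕ-injective (trans p (sym q))

  cyclicSuc-injective : ∀ {i j k : Fin n} → CyclicSuc i k → CyclicSuc j k → i ≡ j
  cyclicSuc-injective (inj₁ p) (inj₁ q) = toℕ-injective (suc-injective (trans (sym p) q))
  cyclicSuc-injective (inj₁ p) (inj₂ (_ , q)) with () ← trans (sym p) q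
  cyclicSuc-injective (inj₂ (_ , p)) (inj₁ q) with () ← trans (sym p) q
  cyclicSuc-injective (inj₂ (p , _)) (inj₂ (q , _)) =
    toℕ-injective (suc-injective (trans p (sym q)))

  -- The map `opposite` sends index `i` to `n - 1 - i`. It serves to relabel a cycle all of whose
  -- arcs run against the labelling.
  cyclicSuc-opposite : ∀ {i j : Fin n} → CyclicSuc i j → CyclicSuc (opposite j) (opposite i)
  cyclicSuc-opposite {i} {j} (inj₁ j≡1+i) = inj₁ (begin
    toℕ (opposite i)        ≡⟨ opposite-prop i ⟩
    n ∸ suc (toℕ i)         ≡⟨ cong (n ∸_) j≡1+i ⟨
    -- `suc` commutes with truncated subtraction here because `toℕ j < n`.
    suc n ∸ suc (toℕ j)     ≡⟨ +-∸-assoc 1 (toℕ<n j) ⟩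
    suc (n ∸ suc (toℕ j))   ≡⟨ cong suc (opposite-prop j) ⟨
    suc (toℕ (opposite j))  ∎)
    where open ≡-Reasoning
  cyclicSuc-opposite {i} {j} (inj₂ (1+i≡n , j≡0)) = inj₂ (last , first)
    where
    open ≡-Reasoning
    last : suc (toℕ (opposite j)) ≡ n
    last = begin
      suc (toℕ (opposite j))  ≡⟨ cong suc (opposite-prop j) ⟩
      suc (n ∸ suc (toℕ j))   ≡⟨ +-∸-assoc 1 (toℕ<n j) ⟨
      n ∸ toℕ j               ≡⟨ cong (n ∸_) j≡0 ⟩
      n                       ∎
    first : toℕ (opposite i) ≡ 0
    first = begin
      toℕ (opposite i)  ≡⟨ opposite-prop i ⟩
      n ∸ suc (toℕ i)   ≡⟨ cong (n ∸_) 1+i≡n ⟩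
      n ∸ n             ≡⟨ n∸n≡0 n ⟩
      0                 ∎

  cyclicSuc-opposite⁻ : ∀ {i j : Fin n} → CyclicSuc (opposite i) (opposite j) → CyclicSuc j i
  cyclicSuc-opposite⁻ {i} {j} c =
    subst₂ CyclicSuc (opposite-involutive j) (opposite-involutive i) (cyclicSuc-opposite c)

  cycleAdj-opposite⁻ : ∀ {i j : Fin n} → CycleAdj (opposite i) (opposite j) → CycleAdj i j
  cycleAdj-opposite⁻ (fwd c) = bwd (cyclicSuc-opposite⁻ c)
  cycleAdj-opposite⁻ (bwd c) = fwd (cyclicSuc-opposite⁻ c)

-- Climb from `i` to the last index, wrap around to `0`, then climb through all indices.
cyclic-induction : ∀ {n} (P : Fin n → Set) → (∀ {i j} → CyclicSuc i j → P i → P j) →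
  ∀ {i} → P i → ∀ j → P j
cyclic-induction {suc n} P step {i} Pi = <-weakInduction P P₀ up
  where
  up : ∀ j → P (inject₁ j) → P (suc j)
  up j = step (inj₁ (cong suc (sym (toℕ-inject₁ j))))
  P₀ : P zero
  P₀ = step (inj₂ (cong suc (toℕ-fromℕ n) , refl))
    (<-weakInduction-startingFrom P Pi up (≤fromℕ i))

-- Zero forcing: sets that fail and sets that succeed.

module _ {n : ℕ} (D : Digraph n) where
  open Digraph D

  forced⇒inNeighbour : ∀ {B w} → Forced D B w → ∃[ v ] v ⟶ w
  forced⇒inNeighbour {B} {w} (v , _ , eq) =
    v , ∈-tabulate⁻ (v ⟶?_) (p─q⊆p (N⁺ v) B (subst (w ∈_) (sym eq) (x∈⁅x⁆ w)))

  soleOutNeighbour⇒forced : ∀ {B v w} → v ∈ B → w ∉ B → v ⟶ w → (∀ {u} → v ⟶ u → u ≡ w) →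
    Forced D B w
  soleOutNeighbour⇒forced {B} {v} {w} v∈B w∉B v⟶w sole = v , v∈B , ⊆-antisym to from
    where
    to : N⁺ v ─ B ⊆ ⁅ w ⁆
    to x∈ with refl ← sole (∈-tabulate⁻ (v ⟶?_) (p─q⊆p (N⁺ v) B x∈)) = x∈⁅x⁆ w
    from : ⁅ w ⁆ ⊆ N⁺ v ─ B
    from x∈ with refl ← x∈⁅y⁆⇒x≡y w x∈ = x∈p∧x∉q⇒x∈p─q (∈-tabulate⁺ (v ⟶?_) v⟶w) w∉B

  B-mono : ∀ {S s t} → s ≤ t → B[_] D s S ⊆ B[_] D t S
  B-mono {S} s≤t = go (≤⇒≤′ s≤t)
    where
    go : ∀ {s t} → s ≤′ t → B[_] D s S ⊆ B[_] D t S
    go ≤′-refl       x∈ = x∈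
    go (≤′-step s≤t) x∈ = p⊆p∪q _ (go s≤t x∈)

  -- Either `w` is blue already, or it is the only white out-neighbour of `v` and is forced.
  B-soleOutNeighbour : ∀ {S v w} t → v ⟶ w → (∀ {u} → v ⟶ u → u ≡ w) →
    v ∈ B[_] D t S → w ∈ B[_] D (suc t) S
  B-soleOutNeighbour {S} {v} {w} t v⟶w sole v∈ with w ∈? B[_] D t S
  ... | yes w∈ = p⊆p∪q _ w∈
  ... | no  w∉ = q⊆p∪q _ _
    (∈-tabulate⁺ (forced? D (B[_] D t S)) (soleOutNeighbour⇒forced v∈ w∉ v⟶w sole))

  -- Forcing needs a blue vertex, so the empty set never grows; since there is a vertex, it never
  -- equals `⊤`.
  ⊥-failed : IsFZFS D ⊥
  ⊥-failed (t , eq) = stays t (vertex nonEmpty) (subst (vertex nonEmpty ∈_) (sym eq) ∈⊤)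
    where
    vertex : ∀ {n} → NonZero n → Fin n
    vertex {suc n} _ = zero
    stays : ∀ t x → x ∉ B[_] D t ⊥
    stays zero    x x∈ = ∉⊥ x∈
    stays (suc t) x x∈ with x∈p∪q⁻ _ _ x∈
    ... | inj₁ x∈B = stays t x x∈B
    ... | inj₂ x∈F with v , v∈B , _ ← ∈-tabulate⁻ (forced? D (B[_] D t ⊥)) x∈F = stays t v v∈B

  source-unforced : ∀ {S v} → (∀ u → ¬ u ⟶ v) → v ∉ S → ∀ t → v ∉ B[_] D t S
  source-unforced src v∉S zero v∈ = v∉S v∈
  source-unforced {S} src v∉S (suc t) v∈ with x∈p∪q⁻ _ _ v∈
  ... | inj₁ v∈B = source-unforced src v∉S t v∈B
  ... | inj₂ v∈F with u , u⟶v ← forced⇒inNeighbour (∈-tabulate⁻ (forced? D (B[_] D t S)) v∈F) =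
    src u u⟶v

  source⇒∁-failed : ∀ {v} → (∀ u → ¬ u ⟶ v) → IsFZFS D (∁ ⁅ v ⁆)
  source⇒∁-failed {v} src (t , eq) =
    source-unforced src (x∈p⇒x∉∁p (x∈⁅x⁆ v)) t (subst (v ∈_) (sym eq) ∈⊤)

  failed⇒∣S∣≤n∸1 : ∀ S → IsFZFS D S → ∣ S ∣ ≤ n ∸ 1
  failed⇒∣S∣≤n∸1 S failed =
    <⇒≤pred (≤∧≢⇒< (∣p∣≤n S) λ ∣S∣≡n → failed (0 , ∣p∣≡n⇒p≡⊤ ∣S∣≡n))

  source⇒F≡n∸1 : (∃[ v ] ∀ u → ¬ u ⟶ v) → FailedZeroForcingNumberIs D (n ∸ 1)
  source⇒F≡n∸1 (v , src) =
    (∁ ⁅ v ⁆ , source⇒∁-failed src , trans (∣∁p∣≡n∸∣p∣ ⁅ v ⁆) (cong (n ∸_) (∣⁅x⁆∣≡1 v)))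
    , failed⇒∣S∣≤n∸1

  -- Blueness passes along each arc in one time step. The induction starts at the index of `v` at
  -- time `0` and yields a time for each index; a common one exists because blue sets only grow.
  directed⇒nonempty-ZFS : IsDirectedCycle D → ∀ {S v} → v ∈ S → IsZFS D S
  directed⇒nonempty-ZFS (π , arcs) {S} v∈S = covered
    (uniform-bound (λ i t → π ⟨$⟩ʳ i ∈ B[_] D t S) (λ s≤t → B-mono s≤t)
      (cyclic-induction (λ i → ∃[ t ] π ⟨$⟩ʳ i ∈ B[_] D t S) step
        (0 , subst (_∈ S) (sym (inverseʳ π)) v∈S)))
    where
    step : ∀ {i j} → CyclicSuc i j →
      ∃[ t ] π ⟨$⟩ʳ i ∈ B[_] D t S → ∃[ t ] π ⟨$⟩ʳ j ∈ B[_] D t S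
    step {i} {j} c (t , πi∈) =
      suc t , B-soleOutNeighbour t (Equivalence.from (arcs i j) c) sole πi∈
      where
      sole : ∀ {u} → π ⟨$⟩ʳ i ⟶ u → u ≡ π ⟨$⟩ʳ j
      sole {u} e = trans (sym (inverseʳ π)) (cong (π ⟨$⟩ʳ_) (cyclicSuc-functional
        (Equivalence.to (arcs i (π ⟨$⟩ˡ u)) (subst (π ⟨$⟩ʳ i ⟶_) (sym (inverseʳ π)) e)) c))
    covered : ∃[ t ] (∀ i → π ⟨$⟩ʳ i ∈ B[_] D t S) → IsZFS D S
    covered (t , all∈) = t , ⊆-antisym (λ _ → ∈⊤)
      λ {x} _ → subst (_∈ B[_] D t S) (inverseʳ π) (all∈ (π ⟨$⟩ˡ x))

  directed⇒F≡0 : IsDirectedCycle D → FailedZeroForcingNumberIs D 0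
  directed⇒F≡0 directed = (⊥ , ⊥-failed , ∣⊥∣≡0 n) , bound
    where
    bound : ∀ S → IsFZFS D S → ∣ S ∣ ≤ 0
    bound S failed with nonempty? S
    ... | yes (_ , v∈S) = contradiction (directed⇒nonempty-ZFS directed v∈S) failed
    ... | no  empty     = ≤-reflexive (trans (cong ∣_∣ (Empty-unique empty)) (∣⊥∣≡0 n))

  -- An arc joins cyclically adjacent indices; one running backward would oppose the forward arc on
  -- the same pair, against asymmetry.
  allForward⇒directed : IsOriented D → (π : Permutation′ n) →
    (∀ {i j} → Underlying D (π ⟨$⟩ʳ i) (π ⟨$⟩ʳ j) → CycleAdj i j) →
    (∀ {i j} → CyclicSuc i j → π ⟨$⟩ʳ i ⟶ π ⟨$⟩ʳ j) → IsDirectedCycle D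
  allForward⇒directed asym π adj forward = π , λ i j → mk⇔ (to i j) forward
    where
    to : ∀ i j → π ⟨$⟩ʳ i ⟶ π ⟨$⟩ʳ j → CyclicSuc i j
    to i j e with adj (fwd e)
    ... | fwd c = c
    ... | bwd c = contradiction (forward c) (asym e)

  -- Oriented cycles without a source.

  module _ (C : IsOrientedCycle D) (inNeighbour : ∀ v → ∃[ u ] u ⟶ v) where
    open IsOrientedCycle C

    private
      π : Permutation′ n
      π = proj₁ cycle

      adjacent : ∀ {i j} → Underlying D (π ⟨$⟩ʳ i) (π ⟨$⟩ʳ j) → CycleAdj i j
      adjacent = Equivalence.to (proj₂ cycle _ _)

      -- With the successor `j` bundled in, `∃ (Backward i)` is a predicate of `i` alone, as
      -- `cyclic-induction` requires.
      Backward : Fin n → Fin n → Set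
      Backward i j = CyclicSuc i j × π ⟨$⟩ʳ j ⟶ π ⟨$⟩ʳ i

    -- Some `u` has an arc into `π j`, and its index precedes or follows `j`. The predecessor is
    -- `i`, which the backward arc from `π j` to `π i` excludes, so the arc from `u` is backward
    -- too.
    backward-propagates : ∀ {i j} → CyclicSuc i j → ∃ (Backward i) → ∃ (Backward j)
    backward-propagates {i} {j} c (_ , c′ , e) with refl ← cyclicSuc-functional c c′
      with u , u⟶πj ← inNeighbour (π ⟨$⟩ʳ j)
      with u⟶πj′ ← subst (_⟶ π ⟨$⟩ʳ j) (sym (inverseʳ π)) u⟶πj
      with adjacent (fwd u⟶πj′)
    ... | bwd j→k = π ⟨$⟩ˡ u , j→k , u⟶πj′
    ... | fwd k→j with refl ← cyclicSuc-injective k→j c = contradiction u⟶πj′ (oriented e)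

    sourceless⇒directed : IsDirectedCycle D
    sourceless⇒directed
      with any? (λ i → any? (λ j → cyclicSuc? i j ×-dec π ⟨$⟩ʳ j ⟶? π ⟨$⟩ʳ i))
    ... | no ¬backward = allForward⇒directed oriented π adjacent forward
      where
      forward : ∀ {i j} → CyclicSuc i j → π ⟨$⟩ʳ i ⟶ π ⟨$⟩ʳ j
      forward {i} {j} c with Equivalence.from (proj₂ cycle i j) (fwd c)
      ... | fwd e = e
      ... | bwd e = contradiction (i , j , c , e) ¬backward
    ... | yes (_ , someBackward) =
      -- All arcs run backward, so the labelling `π (opposite i)` makes them all run forward.
      allForward⇒directed oriented (reverse ∘ₚ π)
        (cycleAdj-opposite⁻ ∘ adjacent) (backward ∘ cyclicSuc-opposite)
      where
      backward : ∀ {i j} → CyclicSuc i j → π ⟨$⟩ʳ j ⟶ π ⟨$⟩ʳ i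
      backward {i} c with cyclic-induction (∃ ∘ Backward) backward-propagates someBackward i
      -- The induction returns some successor of `i`; uniqueness identifies it with `j`.
      ... | _ , c′ , e with refl ← cyclicSuc-functional c c′ = e

  -- Having a source and having an in-neighbour are decidable by finite search, so both existence
  -- claims may be proved by contradiction.
  nonDirected⇒source : IsOrientedCycle D → ¬ IsDirectedCycle D → ∃[ v ] ∀ u → ¬ u ⟶ v
  nonDirected⇒source C ¬directed =
    decidable-stable (any? λ v → all? λ u → ¬? (u ⟶? v)) λ ¬source →
      ¬directed (sourceless⇒directed C λ v →
        decidable-stable (any? (_⟶? v)) λ ¬in → ¬source (v , λ u e → ¬in (u , e)))

theorem4p8 : ∀ (n : ℕ) (D : Digraph n) → IsOrientedCycle D →
    (IsDirectedCycle D → FailedZeroForcingNumberIs D 0)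
    × (¬ IsDirectedCycle D → FailedZeroForcingNumberIs D (n ∸ 1))
theorem4p8 n D C = directed⇒F≡0 D , source⇒F≡n∸1 D ∘ nonDirected⇒source D C
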